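{- Let $O$ be a set of Boolean functions. If $O\preceq\{\land,\top,\bot\}$ or $O\preceq\{\lor,\top,\bot\}$ or $O\preceq\{\neg,\bot\}$, then every $\mathrm{PL}_O$-formula $\phi$ is uniquely characterized with respect to $\mathrm{PL}_O$ by a set of at most $|\phi|_{\mathrm{dag}}+1$ labeled examples. Otherwise, there is no polynomial $p$ such that every $\mathrm{PL}_O$-formula $\phi$ is uniquely characterized with respect to $\mathrm{PL}_O$ by a set of at most $p(|\phi|_{\mathrm{dag}})$ labeled examples.
   Context: A Boolean function is a map $\{0,1\}^n\to\{0,1\}$ with $n\ge 1$; the constants $\top,\bot$ are treated as constant unary functions. For a set $O$ of Boolean functions, $\mathrm{PL}_O$ is the set of propositional formulas generated by $\phi::= x\mid f(\phi_1,\dots,\phi_n)$ with $x$ ranging over a fixed countably infinite set of propositional variables and $f\in O$ $n$-ary, with the obvious semantics. $O\preceq O'$ means that the clone generated by $O$ (smallest set of Boolean functions containing $O$ and all projections, closed under composition) is contained in the clone generated by $O'$. A labeled example is a pair $(V,\mathrm{lab})$ with $V$ a truth assignment and $\mathrm{lab}\in\{0,1\}$; $\phi$ fits it if $\phi$ evaluates to $\mathrm{lab}$ under $V$. A set $E$ of labeled examples uniquely characterizes $\phi$ with respect to $\mathrm{PL}_O$ if $\phi$ fits all of $E$ and every $\mathrm{PL}_O$-formula fitting all of $E$ is equivalent to $\phi$. $|\phi|_{\mathrm{dag}}$ is the number of distinct subformulas of $\phi$. -}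

module Defs where

open import Data.Bool using (Bool; true; false; _∧_; _∨_; not; if_then_else_)
import Data.Bool as B
open import Data.Nat using (ℕ; zero; suc; _+_; _*_; _≡ᵇ_)
import Data.Nat as N
open import Data.Fin using (Fin)
open import Data.Vec using (Vec; []; _∷_; tabulate; lookup)
open import Data.List using (List; []; _∷_; [_]; concatMap; length; foldr; deduplicateᵇ; allFin)
open import Data.List.Relation.Unary.All using (All)
open import Data.Product using (Σ; _×_; _,_; ∃)
open import Data.Sum using (_⊎_)
open import Data.Empty using (⊥)
open import Relation.Nullary using (yes; no; does)
open import Relation.Binary.PropositionalEquality using (_≡_; refl)

BoolFun : Set
BoolFun = Σ ℕ (λ n → Vec Bool (suc n) → Bool)

FunSet : Set₁
FunSet = BoolFun → Set

data Fm (O : FunSet) (X : Set) : Set where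
  var : X → Fm O X
  app : (n : ℕ) (f : Vec Bool (suc n) → Bool) → O (n , f) →
        (Fin (suc n) → Fm O X) → Fm O X

eval : {O : FunSet} {X : Set} → Fm O X → (X → Bool) → Bool
eval (var x) V = V x
eval (app n f _ as) V = f (tabulate (λ i → eval (as i) V))

PL : FunSet → Set
PL O = Fm O ℕ

Assignment : Set
Assignment = ℕ → Bool

-- Clone generated by O: the term functions of O (projections = variables,
-- composition = substitution), taken up to extensional equality.
InClone : FunSet → FunSet
InClone O (n , f) = Σ (Fm O (Fin (suc n))) λ t → ∀ (v : Vec Bool (suc n)) → eval t (lookup v) ≡ f v

_⪯_ : FunSet → FunSet → Set
O ⪯ O' = ∀ (b : BoolFun) → InClone O b → InClone O' b

-- Concrete sets (membership extensional). Constants are unary functions.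
IsTop IsBot : BoolFun → Set
IsTop (zero , f) = ∀ a → f (a ∷ []) ≡ true
IsTop (suc _ , f) = ⊥
IsBot (zero , f) = ∀ a → f (a ∷ []) ≡ false
IsBot (suc _ , f) = ⊥

IsAnd IsOr IsNeg : BoolFun → Set
IsAnd (suc zero , f) = ∀ a b → f (a ∷ b ∷ []) ≡ (a ∧ b)
IsAnd _ = ⊥
IsOr (suc zero , f) = ∀ a b → f (a ∷ b ∷ []) ≡ (a ∨ b)
IsOr _ = ⊥
IsNeg (zero , f) = ∀ a → f (a ∷ []) ≡ not a
IsNeg _ = ⊥

AndTopBot OrTopBot NegBot : FunSet
AndTopBot b = IsAnd b ⊎ IsTop b ⊎ IsBot b
OrTopBot b = IsOr b ⊎ IsTop b ⊎ IsBot b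
NegBot b = IsNeg b ⊎ IsBot b

Example : Set
Example = Assignment × Bool

Fits : {O : FunSet} → PL O → Example → Set
Fits φ (V , lab) = eval φ V ≡ lab

Equivalent : {O : FunSet} → PL O → PL O → Set
Equivalent φ ψ = ∀ (V : Assignment) → eval φ V ≡ eval ψ V

UniquelyCharacterizes : (O : FunSet) → List Example → PL O → Set
UniquelyCharacterizes O E φ =
  All (Fits φ) E × (∀ (ψ : PL O) → All (Fits ψ) E → Equivalent ψ φ)

CharacterizedWithin : (O : FunSet) → PL O → ℕ → Set
CharacterizedWithin O φ k =
  Σ (List Example) λ E → length E N.≤ k × UniquelyCharacterizes O E φ

allᵇ : {A : Set} → (A → Bool) → List A → Bool
allᵇ p = foldr (λ x r → p x ∧ r) true

-- Syntactic identity of formulas (function symbols identified as functions,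
-- i.e. extensionally; decidable by enumerating the finite domain).
allVecs : (n : ℕ) → List (Vec Bool n)
allVecs zero = [ [] ]
allVecs (suc n) = concatMap (λ v → (true ∷ v) ∷ (false ∷ v) ∷ []) (allVecs n)

eqFunᵇ : {n : ℕ} → (Vec Bool n → Bool) → (Vec Bool n → Bool) → Bool
eqFunᵇ {n} f g = allᵇ (λ v → does (f v B.≟ g v)) (allVecs n)

sameᵇ : {O : FunSet} → PL O → PL O → Bool
sameᵇ (var x) (var y) = x ≡ᵇ y
sameᵇ (var x) (app _ _ _ _) = false
sameᵇ (app _ _ _ _) (var y) = false
sameᵇ (app n f _ as) (app m g _ bs) with n N.≟ m
... | yes refl = eqFunᵇ f g ∧ allᵇ (λ i → sameᵇ (as i) (bs i)) (allFin (suc n))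
... | no _ = false

subformulas : {O : FunSet} → PL O → List (PL O)
subformulas (var x) = [ var x ]
subformulas (app n f p as) = app n f p as ∷ concatMap (λ i → subformulas (as i)) (allFin (suc n))

dagSize : {O : FunSet} → PL O → ℕ
dagSize φ = length (deduplicateᵇ sameᵇ (subformulas φ))

evalPoly : List ℕ → ℕ → ℕ
evalPoly [] x = 0
evalPoly (c ∷ cs) x = c + x * evalPoly cs x

{-# OPTIONS --safe #-}
module Submission where

-- Below {∧,⊤,⊥} every formula is a conjunction of some of its variables, and such a
-- conjunction is pinned down by the set of its variables and by the coatoms omitting one
-- of them; the other two cases are similar.  Otherwise, by a fragment of Post's
-- classification, the clone contains x ∧ (y ∨ z), its dual, majority or x ⊕ y ⊕ z.
-- With x ⊕ y ⊕ z not even a variable is characterized by finitely many examples.  In the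
-- other cases z ∧ ⋀ᵢ (xᵢ ∨ yᵢ) has linear size and exponentially many minimal models;
-- each of them can be removed by a formula that differs (essentially) nowhere else, hence
-- must occur among the examples.  Majority is covered because maj (u , x , maj (x , y , z))
-- is x ∧ (y ∨ z) for u = 0 and the dual for u = 1.

open import Defs
open import Data.Bool using (Bool; true; false; _∧_; _∨_; _xor_; not; if_then_else_; T)
import Data.Bool as B
open import Data.Bool.Properties
  using (T-≡; ⇔→≡; ∧-assoc; ∧-identityʳ; ∧-zeroʳ; ∨-identityʳ; ∨-inverseʳ; ∨-zeroʳ;
         not-involutive; ¬-not; xor-same; xor-assoc; xor-comm; xor-identityʳ; not-distribʳ-xor; if-eta)
open import Data.Empty using (⊥)
open import Data.Fin using (Fin; zero; suc; toℕ; combine; quotient; remainder; #_)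
import Data.Fin.Properties as F
open import Data.List using (List; []; _∷_; _++_; map; length; allFin; deduplicate; filter)
import Data.List as L
open import Data.List.Membership.Propositional using (_∈_; find; lose)
open import Data.List.Membership.Propositional.Properties
open import Data.List.Properties using (length-map; length-++)
open import Data.List.Relation.Unary.All using (All; []; _∷_)
import Data.List.Relation.Unary.All as All
import Data.List.Relation.Unary.All.Properties as Allₚ
open import Data.List.Relation.Unary.AllPairs using ([]; _∷_)
import Data.List.Relation.Unary.AllPairs.Properties as AllPairsₚ
open import Data.List.Relation.Unary.Any using (Any; here; there; index)
import Data.List.Relation.Unary.Any as Any
import Data.List.Relation.Unary.Any.Properties as Anyₚ
open import Data.List.Relation.Unary.Unique.Propositional using (Unique)
import Data.List.Relation.Unary.Unique.Propositional.Properties as Uniqueₚ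
open import Data.List.Relation.Unary.Unique.DecPropositional.Properties using (deduplicate-!)
open import Data.Maybe using (Maybe; nothing; just)
open import Data.Nat using (ℕ; zero; suc; _+_; _*_; _^_; _≤_; _<_; z≤n; s≤s; _≡ᵇ_)
import Data.Nat as N
open import Data.Nat.ListAction using (sum)
open import Data.Nat.Properties hiding (_≟_)
open import Data.Product using (Σ; ∃; _×_; _,_; proj₁; proj₂)
open import Data.Sum using (_⊎_; inj₁; inj₂; [_,_]′)
open import Data.Vec using (Vec; []; _∷_; tabulate; lookup)
open import Data.Vec.Properties using (tabulate-cong; tabulate∘lookup; lookup∘tabulate)
open import Function using (_∘_; id; mk⇔; Equivalence)
open import Relation.Nullary using (¬_; yes; no; does; contradiction)
open import Relation.Binary.PropositionalEquality

variable
  O O′ : FunSet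
  X Y : Set

-- Boolean identities and counting in lists

xor-cancelˡ : ∀ s x → s xor (s xor x) ≡ x
xor-cancelˡ false x = refl
xor-cancelˡ true false = refl
xor-cancelˡ true true = refl

≡-from-true : ∀ {a b} → (a ≡ true → b ≡ true) → (b ≡ true → a ≡ true) → a ≡ b
≡-from-true f g = ⇔→≡ (mk⇔ f g)

false≢true : ∀ {b} → b ≡ false → ¬ b ≡ true
false≢true refl ()

∧-true⁻ : ∀ {a b} → a ∧ b ≡ true → a ≡ true × b ≡ true
∧-true⁻ {true} e = refl , e

∨-false⁻ : ∀ {a b} → a ∨ b ≡ false → a ≡ false × b ≡ false
∨-false⁻ {false} e = refl , e

allᵇ⁺ : {A : Set} {p : A → Bool} (xs : List A) →
  (∀ {x} → x ∈ xs → p x ≡ true) → allᵇ p xs ≡ true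
allᵇ⁺ [] h = refl
allᵇ⁺ (x ∷ xs) h = cong₂ _∧_ (h (here refl)) (allᵇ⁺ xs (h ∘ there))

allᵇ⁻ : {A : Set} {p : A → Bool} {xs : List A} {x : A} → allᵇ p xs ≡ true → x ∈ xs → p x ≡ true
allᵇ⁻ e (here refl) = proj₁ (∧-true⁻ e)
allᵇ⁻ e (there m) = allᵇ⁻ (proj₂ (∧-true⁻ e)) m

-- Sending `i` to the position of its witness is injective, since no entry can serve two indices.
matching⇒≤ : {B : Set} {m : ℕ} {ys : List B} (R : Fin m → B → Set) →
  (∀ i → Any (R i) ys) → (∀ {i j y} → R i y → R j y → i ≡ j) → m ≤ length ys
matching⇒≤ {ys = ys} R p clash = F.injective⇒≤ {f = λ i → index (p i)} λ {i} {j} eq →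
  clash (Anyₚ.lookup-index (p i))
        (subst (λ k → R j (L.lookup ys k)) (sym eq) (Anyₚ.lookup-index (p j)))

unique-lookup : {A : Set} {xs : List A} → Unique xs → ∀ i j → L.lookup xs i ≡ L.lookup xs j → i ≡ j
unique-lookup (_ ∷ _) zero zero e = refl
unique-lookup {xs = x ∷ xs} (p ∷ _) zero (suc j) e = contradiction e (All.lookup p (∈-lookup j))
unique-lookup {xs = x ∷ xs} (p ∷ _) (suc i) zero e = contradiction (sym e) (All.lookup p (∈-lookup i))
unique-lookup (_ ∷ u) (suc i) (suc j) e = cong suc (unique-lookup u i j e)

unique-⊆⇒≤ : {A : Set} {xs ys : List A} → Unique xs → (∀ {x} → x ∈ xs → x ∈ ys) →
  length xs ≤ length ys
unique-⊆⇒≤ {xs = xs} u sub = matching⇒≤ (λ i y → L.lookup xs i ≡ y) (λ i → sub (∈-lookup i))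
  (λ {i} {j} e e' → unique-lookup u i j (trans e (sym e')))

-- Size of a formula

eqFunᵇ-refl : {n : ℕ} (f : Vec Bool n → Bool) → eqFunᵇ f f ≡ true
eqFunᵇ-refl {n} f = allᵇ⁺ (allVecs n) (λ {v} _ → same (f v))
  where
  same : ∀ b → does (b B.≟ b) ≡ true
  same true = refl
  same false = refl

≡ᵇ-refl : ∀ x → (x ≡ᵇ x) ≡ true
≡ᵇ-refl x = Equivalence.to T-≡ (≡⇒≡ᵇ x x refl)

sameᵇ-refl : (φ : PL O) → sameᵇ φ φ ≡ true
sameᵇ-refl (var x) = ≡ᵇ-refl x
sameᵇ-refl (app n f o as) with n N.≟ n
... | yes refl = cong₂ _∧_ (eqFunᵇ-refl f) (allᵇ⁺ (allFin (suc n)) (λ {i} _ → sameᵇ-refl (as i)))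
... | no n≢n = contradiction refl n≢n

sameᵇ-var : (φ : PL O) (x : ℕ) → T (sameᵇ φ (var x)) → φ ≡ var x
sameᵇ-var (var y) x e = cong var (≡ᵇ⇒≡ y x e)

deduplicateᵇ-unique : {A : Set} (r : A → A → Bool) → (∀ x → r x x ≡ true) →
  ∀ xs → Unique (L.deduplicateᵇ r xs)
deduplicateᵇ-unique r r-refl [] = []
deduplicateᵇ-unique r r-refl (x ∷ xs) =
  All.map (λ { {y} ¬rxy refl → ¬rxy (Equivalence.from T-≡ (r-refl x)) })
          (Allₚ.all-filter _ (L.deduplicateᵇ r xs))
  ∷ AllPairsₚ.filter⁺ _ (deduplicateᵇ-unique r r-refl xs)

-- Reflexivity of `sameᵇ` suffices: after deduplication no two entries are propositionally equal, so
-- they embed into any list that covers them.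
dagSize≤ : (φ : PL O) (ψs : List (PL O)) → (∀ {ψ} → ψ ∈ subformulas φ → ψ ∈ ψs) →
  dagSize φ ≤ length ψs
dagSize≤ φ ψs cover = unique-⊆⇒≤ (deduplicateᵇ-unique sameᵇ sameᵇ-refl (subformulas φ))
  (cover ∘ ∈-deduplicate⁻ _ (subformulas φ))

-- `sameᵇ` relates a variable only to itself, so deduplication keeps one copy of every variable that
-- occurs.
dagSize≥ : (φ : PL O) {xs : List ℕ} → Unique xs → (∀ {x} → x ∈ xs → var x ∈ subformulas φ) →
  length xs ≤ dagSize φ
dagSize≥ {O} φ {xs} u occurs = subst (_≤ dagSize φ) (length-map var xs)
  (unique-⊆⇒≤ (Uniqueₚ.map⁺ var-injective u) kept)
  where
  var-injective : ∀ {x y} → var {O} x ≡ var y → x ≡ y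
  var-injective refl = refl
  kept : ∀ {ψ} → ψ ∈ map var xs → ψ ∈ L.deduplicateᵇ sameᵇ (subformulas φ)
  kept m with ∈-map⁻ var m
  ... | x , x∈xs , refl =
    Anyₚ.deduplicate⁺ _ (λ {a} {b} r e → sym (sameᵇ-var b x (subst (λ c → T (sameᵇ b c)) (sym e) r)))
      (occurs x∈xs)

-- Substitution and signed evaluation

sub : Fm O X → (X → Fm O Y) → Fm O Y
sub (var x) σ = σ x
sub (app n f o as) σ = app n f o (λ i → sub (as i) σ)

eval-cong : (t : Fm O X) {V W : X → Bool} → V ≗ W → eval t V ≡ eval t W
eval-cong (var x) eq = eq x
eval-cong (app n f o as) eq = cong f (tabulate-cong (λ i → eval-cong (as i) eq))

eval-sub : (t : Fm O X) (σ : X → Fm O Y) (V : Y → Bool) →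
  eval (sub t σ) V ≡ eval t (λ x → eval (σ x) V)
eval-sub (var x) σ V = refl
eval-sub (app n f o as) σ V = cong f (tabulate-cong (λ i → eval-sub (as i) σ V))

-- The sign s = true replaces every operation by its De Morgan dual, so that
-- the ∧-side and the ∨-side of the theorem are handled at once.
ev : Bool → Fm O X → (X → Bool) → Bool
ev s t V = s xor eval t (λ x → s xor V x)

ev-cong : ∀ s (t : Fm O X) {V W : X → Bool} → V ≗ W → ev s t V ≡ ev s t W
ev-cong s t eq = cong (s xor_) (eval-cong t (λ x → cong (s xor_) (eq x)))

ev-var : ∀ s (x : X) (V : X → Bool) → ev {O = O} s (var x) V ≡ V x
ev-var s x V = xor-cancelˡ s (V x)

ev-sub : ∀ s (t : Fm O X) (σ : X → Fm O Y) (V : Y → Bool) →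
  ev s (sub t σ) V ≡ ev s t (λ x → ev s (σ x) V)
ev-sub s t σ V = cong (s xor_) (trans (eval-sub t σ _)
  (eval-cong t (λ x → sym (xor-cancelˡ s (eval (σ x) (λ y → s xor V y))))))

ev-signed : ∀ s (t : Fm O X) (V : X → Bool) → ev s t (λ x → s xor V x) ≡ s xor eval t V
ev-signed s t V = cong (s xor_) (eval-cong t (λ x → xor-cancelˡ s (V x)))

-- Flipping all inputs by `s` is an involution on assignments, so agreement of the signed values
-- everywhere carries over to the plain values.
ev-determines : ∀ s (t : Fm O X) (u : Fm O′ X) → (∀ V → ev s t V ≡ ev s u V) →
  ∀ V → eval t V ≡ eval u V
ev-determines s t u h V = begin
  eval t V                        ≡⟨ xor-cancelˡ s _ ⟨
  s xor (s xor eval t V)          ≡⟨ cong (s xor_) (ev-signed s t V) ⟨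
  s xor ev s t (λ x → s xor V x)  ≡⟨ cong (s xor_) (h _) ⟩
  s xor ev s u (λ x → s xor V x)  ≡⟨ cong (s xor_) (ev-signed s u V) ⟩
  s xor (s xor eval u V)          ≡⟨ xor-cancelˡ s _ ⟩
  eval u V                        ∎
  where open ≡-Reasoning

generator∈clone : ∀ {n f} → O (n , f) → InClone O (n , f)
generator∈clone {f = f} o = app _ _ o var , λ v → cong f (tabulate∘lookup v)

-- Conjunctions

-- nothing stands for the constant false
Conj : Set → Set
Conj X = Maybe (List X)

conj : Conj X → (X → Bool) → Bool
conj nothing V = false
conj (just xs) V = allᵇ V xs

conj-cong : (m : Conj X) {V W : X → Bool} → V ≗ W → conj m V ≡ conj m W
conj-cong nothing eq = refl
conj-cong (just []) eq = refl
conj-cong (just (x ∷ xs)) eq = cong₂ _∧_ (eq x) (conj-cong (just xs) eq)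

_∈ᶜ_ : X → Conj X → Set
x ∈ᶜ nothing = ⊥
x ∈ᶜ just xs = x ∈ xs

_∧ᶜ_ : Conj X → Conj X → Conj X
just xs ∧ᶜ just ys = just (xs ++ ys)
just xs ∧ᶜ nothing = nothing
nothing ∧ᶜ m = nothing

conj-∧ : (m k : Conj X) (V : X → Bool) → conj (m ∧ᶜ k) V ≡ conj m V ∧ conj k V
conj-∧ nothing k V = refl
conj-∧ (just xs) nothing V = ≡-from-true (λ ()) (proj₂ ∘ ∧-true⁻ {allᵇ V xs})
conj-∧ (just xs) (just ys) V = allᵇ-++ xs
  where
  allᵇ-++ : ∀ xs → allᵇ V (xs ++ ys) ≡ allᵇ V xs ∧ allᵇ V ys
  allᵇ-++ [] = refl
  allᵇ-++ (x ∷ xs) = trans (cong (V x ∧_) (allᵇ-++ xs)) (sym (∧-assoc (V x) _ _))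

∈ᶜ-∧ : ∀ (m k : Conj X) {x} → x ∈ᶜ (m ∧ᶜ k) → x ∈ᶜ m ⊎ x ∈ᶜ k
∈ᶜ-∧ (just xs) (just ys) p = ∈-++⁻ xs p

⋀ᶜ : List X → (X → Conj Y) → Conj Y
⋀ᶜ [] σ = just []
⋀ᶜ (x ∷ xs) σ = σ x ∧ᶜ ⋀ᶜ xs σ

_>>=ᶜ_ : Conj X → (X → Conj Y) → Conj Y
nothing >>=ᶜ σ = nothing
just xs >>=ᶜ σ = ⋀ᶜ xs σ

conj->>= : (m : Conj X) (σ : X → Conj Y) (V : Y → Bool) →
  conj (m >>=ᶜ σ) V ≡ conj m (λ x → conj (σ x) V)
conj->>= nothing σ V = refl
conj->>= (just []) σ V = refl
conj->>= (just (x ∷ xs)) σ V =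
  trans (conj-∧ (σ x) (⋀ᶜ xs σ) V) (cong (conj (σ x) V ∧_) (conj->>= (just xs) σ V))

∈ᶜ->>= : ∀ (m : Conj X) (σ : X → Conj Y) {y} → y ∈ᶜ (m >>=ᶜ σ) → ∃ λ x → y ∈ᶜ σ x
∈ᶜ->>= (just xs) σ p = ∈ᶜ-⋀ xs p
  where
  ∈ᶜ-⋀ : ∀ xs {y} → y ∈ᶜ ⋀ᶜ xs σ → ∃ λ x → y ∈ᶜ σ x
  ∈ᶜ-⋀ (x ∷ xs) p = [ x ,_ , ∈ᶜ-⋀ xs ]′ (∈ᶜ-∧ (σ x) (⋀ᶜ xs σ) p)

-- For `s = true` it is the De Morgan dual of `f` that is a conjunction, so `f` itself is a
-- disjunction or a constant.
ConjFun : Bool → BoolFun → Set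
ConjFun s (n , f) = Σ (Conj (Fin (suc n))) λ m →
  ∀ V → s xor f (tabulate (λ i → s xor V i)) ≡ conj m V

data Occurs {O : FunSet} {X : Set} (x : X) : Fm O X → Set where
  here  : Occurs x (var x)
  there : ∀ {n f o as} i → Occurs x (as i) → Occurs x (app n f o as)

occurs-subformula : ∀ {x} {φ : PL O} → Occurs x φ → var x ∈ subformulas φ
occurs-subformula here = here refl
occurs-subformula (there {as = as} i oc) =
  there (∈-concatMap⁺ (λ j → subformulas (as j)) (lose (∈-allFin i) (occurs-subformula oc)))

-- The last component keeps the number of distinct conjuncts below the dag size, which bounds the
-- number of negative examples.
ConjForm : Bool → Fm O X → Set
ConjForm s t = Σ (Conj _) λ m → (∀ V → ev s t V ≡ conj m V) × (∀ {x} → x ∈ᶜ m → Occurs x t)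

conjForm : ∀ s → (∀ b → O b → ConjFun s b) → (t : Fm O X) → ConjForm s t
conjForm {O} s h (var x) = just (x ∷ []) ,
  (λ V → trans (ev-var {O = O} s x V) (sym (∧-identityʳ (V x)))) ,
  λ { (here refl) → here }
conjForm s h (app n f o as) =
  m >>=ᶜ (λ i → proj₁ (nf i)) ,
  (λ V → begin
    s xor f (tabulate (λ i → eval (as i) (λ x → s xor V x)))
      ≡⟨ cong (λ v → s xor f v) (tabulate-cong (λ i → xor-cancelˡ s (eval (as i) (λ x → s xor V x)))) ⟨
    s xor f (tabulate (λ i → s xor ev s (as i) V))
      ≡⟨ m-correct _ ⟩
    conj m (λ i → ev s (as i) V)
      ≡⟨ conj-cong m (λ i → proj₁ (proj₂ (nf i)) V) ⟩
    conj m (λ i → conj (proj₁ (nf i)) V)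
      ≡⟨ conj->>= m _ V ⟨
    conj (m >>=ᶜ (λ i → proj₁ (nf i))) V ∎) ,
  λ p → let i , q = ∈ᶜ->>= m (λ i → proj₁ (nf i)) p in there i (proj₂ (proj₂ (nf i)) q)
  where
  open ≡-Reasoning
  nf = λ i → conjForm s h (as i)
  m = proj₁ (h (n , f) o)
  m-correct = proj₂ (h (n , f) o)

Lat : Bool → FunSet
Lat false = AndTopBot
Lat true = OrTopBot

Lat-conjFun : ∀ s b → Lat s b → ConjFun s b
Lat-conjFun false (suc zero , f) (inj₁ p) = just (zero ∷ suc zero ∷ []) ,
  λ V → trans (p _ _) (cong (V zero ∧_) (sym (∧-identityʳ _)))
Lat-conjFun false (zero , f) (inj₂ (inj₁ p)) = just [] , λ V → p _
Lat-conjFun false (zero , f) (inj₂ (inj₂ p)) = nothing , λ V → p _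
Lat-conjFun false (suc _ , f) (inj₂ (inj₁ ()))
Lat-conjFun false (suc _ , f) (inj₂ (inj₂ ()))
Lat-conjFun true (suc _ , f) (inj₂ (inj₁ ()))
Lat-conjFun true (suc _ , f) (inj₂ (inj₂ ()))
Lat-conjFun true (suc zero , f) (inj₁ p) = just (zero ∷ suc zero ∷ []) ,
  λ V → trans (cong not (p _ _)) (de-morgan (V zero) (V (suc zero)))
  where
  de-morgan : ∀ a b → not (not a ∨ not b) ≡ a ∧ (b ∧ true)
  de-morgan true true = refl
  de-morgan true false = refl
  de-morgan false b = refl
Lat-conjFun true (zero , f) (inj₂ (inj₁ p)) = nothing , λ V → cong not (p _)
Lat-conjFun true (zero , f) (inj₂ (inj₂ p)) = just [] , λ V → cong not (p _)

⪯Lat⇒conjFun : ∀ s → O ⪯ Lat s → ∀ b → O b → ConjFun s b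
⪯Lat⇒conjFun s O⪯ (n , f) o with O⪯ (n , f) (generator∈clone o)
... | t , t-correct with conjForm s (Lat-conjFun s) t
... | m , m-correct , _ = m , λ V → trans (cong (s xor_) (sym (trans
  (eval-cong t (λ i → sym (lookup∘tabulate (λ j → s xor V j) i))) (t-correct _)))) (m-correct V)

-- Examples that characterize a conjunction

fit : ∀ s (φ : PL O) {V b} → ev s φ V ≡ b → Fits φ ((λ x → s xor V x) , s xor b)
fit s φ e = trans (sym (xor-cancelˡ s _)) (cong (s xor_) e)

unfit : ∀ s (φ : PL O) {V b} → Fits φ ((λ x → s xor V x) , s xor b) → ev s φ V ≡ b
unfit s φ e = trans (cong (s xor_) e) (xor-cancelˡ s _)

-- The positive example forces the conjuncts of a competitor to lie among those of `φ`; the negative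
-- example at `x` forces `x` to be one of its conjuncts.
characterized-conj : ∀ s → (∀ b → O b → ConjFun s b) →
  (φ : PL O) → CharacterizedWithin O φ (dagSize φ + 1)
characterized-conj {O} s h φ with conjForm s h φ
... | nothing , φ-correct , _ =
  -- A conjunction that fails at the all-true point is constantly false, so this example suffices.
  ((λ _ → s xor true) , s xor false) ∷ [] , m≤n+m 1 (dagSize φ) ,
  (fit s φ (φ-correct _) ∷ []) ,
  λ { ψ (e ∷ []) → ev-determines s ψ φ (λ V → trans (ψ-false ψ e V) (sym (φ-correct V))) }
  where
  ψ-false : (ψ : PL O) → eval ψ (λ _ → s xor true) ≡ s xor false → ∀ V → ev s ψ V ≡ false
  ψ-false ψ e V with conjForm s h ψ
  ... | nothing , ψ-correct , _ = ψ-correct V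
  ... | just ys , ψ-correct , _ = contradiction (trans (ψ-correct _) (allᵇ⁺ ys (λ _ → refl)))
                                                (false≢true (unfit s ψ e))
... | just xs , φ-correct , occ = examples , size , fits ,
    λ ψ fs → ev-determines s ψ φ (λ V → trans (unique ψ fs V) (sym (φ-correct V)))
  where
  -- One negative example per variable, not per occurrence; the positive example accounts for the
  -- `+ 1`.
  xs′ = deduplicate N._≟_ xs
  open import Data.List.Membership.DecPropositional N._≟_ using (_∈?_)
  only : ℕ → Bool
  except : ℕ → ℕ → Bool
  only x = does (x ∈? xs)
  except = λ x y → not (x ≡ᵇ y)
  negative : ℕ → Example
  negative x = (λ y → s xor except x y) , s xor false
  examples : List Example
  examples = ((λ y → s xor only y) , s xor true) ∷ map negative xs′
  size : length examples ≤ dagSize φ + 1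
  size rewrite length-map negative xs′ | +-comm (dagSize φ) 1 =
    s≤s (dagSize≥ φ (deduplicate-! N._≟_ xs) (occurs-subformula ∘ occ ∘ ∈-deduplicate⁻ N._≟_ xs))
  only-true : ∀ {x} → x ∈ xs → only x ≡ true
  only-true {x} p with x ∈? xs
  ... | yes _ = refl
  ... | no ¬p = contradiction p ¬p
  only-sound : ∀ {x} → only x ≡ true → x ∈ xs
  only-sound {x} e with x ∈? xs
  only-sound e | yes p = p
  only-sound () | no _
  except-self : ∀ x → except x x ≡ false
  except-self x rewrite ≡ᵇ-refl x = refl
  φ-except : ∀ {x} → x ∈ xs → allᵇ (except x) xs ≡ false
  φ-except {x} p with allᵇ (except x) xs in e
  ... | false = refl
  ... | true = trans (sym (allᵇ⁻ e p)) (except-self x)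
  fits : All (Fits φ) examples
  fits = fit s φ (trans (φ-correct _) (allᵇ⁺ xs only-true)) ∷
    Allₚ.map⁺ (All.tabulate (λ p → fit s φ (trans (φ-correct _) (φ-except (∈-deduplicate⁻ N._≟_ xs p)))))
  unique : (ψ : PL O) → All (Fits ψ) examples → ∀ V → ev s ψ V ≡ allᵇ V xs
  unique ψ (f₀ ∷ fs) V with conjForm s h ψ
  ... | nothing , ψ-correct , _ = contradiction (unfit s ψ f₀) (false≢true (ψ-correct only))
  ... | just ys , ψ-correct , _ = trans (ψ-correct V) (≡-from-true
    (λ e → allᵇ⁺ xs (λ p → allᵇ⁻ e (xs⊆ys p))) (λ e → allᵇ⁺ ys (λ p → allᵇ⁻ e (ys⊆xs p))))
    where
    ys⊆xs : ∀ {x} → x ∈ ys → x ∈ xs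
    ys⊆xs p = only-sound (allᵇ⁻ (trans (sym (ψ-correct _)) (unfit s ψ f₀)) p)
    xs⊆ys : ∀ {x} → x ∈ xs → x ∈ ys
    xs⊆ys {x} p with x ∈? ys
    ... | yes q = q
    ... | no ¬q = contradiction (trans (ψ-correct _) (allᵇ⁺ ys (λ {y} q → distinct y q)))
        (false≢true (unfit s ψ (All.lookup (Allₚ.map⁻ fs) (∈-deduplicate⁺ N._≟_ p))))
      where
      distinct : ∀ y → y ∈ ys → except x y ≡ true
      distinct y q with x ≡ᵇ y in e
      ... | false = refl
      ... | true = contradiction (subst (_∈ ys) (sym (≡ᵇ⇒≡ x y (Equivalence.from T-≡ e))) q) ¬q

-- Conjunctions as terms over the lattice bases

meet : Bool → Vec Bool 2 → Bool
meet s (a ∷ b ∷ []) = s xor ((s xor a) ∧ (s xor b))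

meet∈Lat : ∀ s → Lat s (1 , meet s)
meet∈Lat false = inj₁ λ a b → refl
meet∈Lat true = inj₁ λ { true b → refl ; false b → not-involutive b }

constant∈Lat : ∀ s b → Lat s (0 , λ _ → b)
constant∈Lat false true = inj₂ (inj₁ λ _ → refl)
constant∈Lat false false = inj₂ (inj₂ λ _ → refl)
constant∈Lat true true = inj₂ (inj₁ λ _ → refl)
constant∈Lat true false = inj₂ (inj₂ λ _ → refl)

conj∈Lat : ∀ s {n} (m : Conj (Fin (suc n))) →
  Σ (Fm (Lat s) (Fin (suc n))) λ t → ∀ V → ev s t V ≡ conj m V
-- Signed evaluation reads the constant `s` as false and `not s` as true.
conj∈Lat s nothing = app 0 (λ _ → s) (constant∈Lat s s) (λ _ → var zero) , λ V → xor-same s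
conj∈Lat s (just []) = app 0 (λ _ → not s) (constant∈Lat s (not s)) (λ _ → var zero) ,
  λ V → xor-inverseʳ s
  where
  xor-inverseʳ : ∀ s → s xor not s ≡ true
  xor-inverseʳ true = refl
  xor-inverseʳ false = refl
conj∈Lat s {n} (just (x ∷ xs)) with conj∈Lat s (just xs)
... | t , t-correct = app 1 (meet s) (meet∈Lat s) args ,
  λ V → trans (xor-cancelˡ s _) (cong₂ _∧_ (xor-cancelˡ s (V x)) (t-correct V))
  where
  args : Fin 2 → Fm (Lat s) (Fin (suc n))
  args zero = var x
  args (suc _) = t

conjTerms⇒⪯Lat : ∀ s →
  (∀ {n} (t : Fm O (Fin (suc n))) → Σ (Conj (Fin (suc n))) λ m → ∀ V → ev s t V ≡ conj m V) →
  O ⪯ Lat s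
conjTerms⇒⪯Lat s h (n , f) (t , t-correct) with h t
... | m , m-correct with conj∈Lat s m
... | u , u-correct = u , λ v →
  trans (ev-determines s u t (λ V → trans (u-correct V) (sym (m-correct V))) (lookup v)) (t-correct v)

-- Essentially unary functions

Unary : Set → Set
Unary X = Bool × Maybe X

unary : Unary X → (X → Bool) → Bool
unary (c , nothing) V = c
unary (c , just x) V = c xor V x

UnaryFun : BoolFun → Set
UnaryFun (n , f) = Σ (Unary (Fin (suc n))) λ u → ∀ V → f (tabulate V) ≡ unary u V

UnaryForm : Fm O X → Set
UnaryForm t = Σ (Unary _) λ u → ∀ V → eval t V ≡ unary u V

unaryForm : (∀ b → O b → UnaryFun b) → (t : Fm O X) → UnaryForm t
unaryForm h (var x) = (false , just x) , λ V → refl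
unaryForm h (app n f o as) with h (n , f) o
... | (c , nothing) , f-correct = (c , nothing) , λ V → f-correct (λ i → eval (as i) V)
... | (c , just i) , f-correct with unaryForm h (as i)
...   | (d , nothing) , i-correct = (c xor d , nothing) ,
        λ V → trans (f-correct (λ i → eval (as i) V)) (cong (c xor_) (i-correct V))
...   | (d , just x) , i-correct = (c xor d , just x) ,
        λ V → trans (f-correct (λ i → eval (as i) V))
                (trans (cong (c xor_) (i-correct V)) (sym (xor-assoc c d (V x))))

NegBot-unaryFun : ∀ b → NegBot b → UnaryFun b
NegBot-unaryFun (zero , f) (inj₁ p) = (true , just zero) , λ V → p _
NegBot-unaryFun (zero , f) (inj₂ p) = (false , nothing) , λ V → p _
NegBot-unaryFun (suc _ , f) (inj₁ ())
NegBot-unaryFun (suc _ , f) (inj₂ ())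

⪯NegBot⇒unaryFun : O ⪯ NegBot → ∀ b → O b → UnaryFun b
⪯NegBot⇒unaryFun O⪯ (n , f) o with O⪯ (n , f) (generator∈clone o)
... | t , t-correct with unaryForm NegBot-unaryFun t
... | u , u-correct = u , λ V → trans (sym (t-correct (tabulate V)))
  (trans (eval-cong t (lookup∘tabulate V)) (u-correct V))

unaryTerms⇒⪯NegBot : (∀ {n} (t : Fm O (Fin (suc n))) → UnaryForm t) → O ⪯ NegBot
unaryTerms⇒⪯NegBot h (n , f) (t , t-correct) with h t
... | u , u-correct = term u , λ v → trans (term-correct u (lookup v)) (trans (sym (u-correct _)) (t-correct v))
  where
  falsum : Fm NegBot (Fin (suc n))
  falsum = app 0 (λ _ → false) (inj₂ λ _ → refl) (λ _ → var zero)
  negation : Fm NegBot (Fin (suc n)) → Fm NegBot (Fin (suc n))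
  negation t = app 0 (λ { (a ∷ []) → not a }) (inj₁ λ _ → refl) (λ _ → t)
  term : Unary (Fin (suc n)) → Fm NegBot (Fin (suc n))
  term (false , nothing) = falsum
  term (true , nothing) = negation falsum
  term (false , just i) = var i
  term (true , just i) = negation (var i)
  term-correct : ∀ u V → eval (term u) V ≡ unary u V
  term-correct (false , nothing) V = refl
  term-correct (true , nothing) V = refl
  term-correct (false , just i) V = refl
  term-correct (true , just i) V = refl

xor-cancel : ∀ c {a b} → c xor a ≡ c xor b → a ≡ b
xor-cancel c {a} {b} e = trans (sym (xor-cancelˡ c a)) (trans (cong (c xor_) e) (xor-cancelˡ c b))

probe : Unary ℕ → Assignment
-- All-true, so that every function depending on a variable changes between this point and the
-- all-false one.
probe (_ , nothing) _ = true
probe (_ , just x) y = x ≡ᵇ y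

-- A function that depends on a variable changes between the all-false point and the probe exactly
-- if its variable is true at the probe. This shows whether `v` depends on a variable and, if so,
-- that it is the one of `u`; the value at the all-false point then settles the constant.
probe-separates : ∀ u v → unary v (probe u) ≡ unary u (probe u) →
  unary v (λ _ → false) ≡ unary u (λ _ → false) → ∀ V → unary v V ≡ unary u V
probe-separates (c , nothing) (d , nothing) e₁ e₂ V = e₂
probe-separates (c , nothing) (d , just y) e₁ e₂ V =
  contradiction (xor-cancel d (trans e₁ (sym e₂))) (λ ())
probe-separates (c , just x) (d , nothing) e₁ e₂ V =
  contradiction (xor-cancel c (trans (sym e₁) e₂)) (λ e → false≢true e (≡ᵇ-refl x))
probe-separates (c , just x) (d , just y) e₁ e₂ V
  with trans (sym (xor-identityʳ d)) (trans e₂ (xor-identityʳ c))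
... | refl = cong (λ z → c xor V z)
  (sym (≡ᵇ⇒≡ x y (Equivalence.from T-≡ (trans (xor-cancel c e₁) (≡ᵇ-refl x)))))

characterized-unary : (∀ b → O b → UnaryFun b) → (φ : PL O) → CharacterizedWithin O φ (dagSize φ + 1)
characterized-unary {O} h φ with unaryForm h φ
... | u , φ-correct =
  (probe u , unary u (probe u)) ∷ ((λ _ → false) , unary u (λ _ → false)) ∷ [] ,
  +-monoˡ-≤ 1 (dagSize>0 φ) , (φ-correct _ ∷ φ-correct _ ∷ []) , unique
  where
  dagSize>0 : (φ : PL O) → 1 ≤ dagSize φ
  dagSize>0 (var x) = s≤s z≤n
  dagSize>0 (app _ _ _ _) = s≤s z≤n
  unique : ∀ ψ → All (Fits ψ) _ → Equivalent ψ φ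
  unique ψ (e₁ ∷ e₂ ∷ []) V with unaryForm h ψ
  ... | v , ψ-correct = trans (ψ-correct V) (trans
    (probe-separates u v (trans (sym (ψ-correct _)) e₁) (trans (sym (ψ-correct _)) e₂) V)
    (sym (φ-correct V)))

-- An exponential lower bound

-- Clause i uses the variables 2 + 2i and 3 + 2i. Variable 1 is the conjunct z, and variable 0 is
-- reserved for the sign.
xᵥ yᵥ : ℕ → ℕ
xᵥ zero = 2
xᵥ (suc i) = suc (suc (xᵥ i))
yᵥ i = suc (xᵥ i)

pairs : (ℕ → Bool) → ℕ → Bool
pairs c zero = c 0
pairs c (suc zero) = not (c 0)
pairs c (suc (suc k)) = pairs (c ∘ suc) k

-- The minimal model of z ∧ ⋀ᵢ (xᵢ ∨ yᵢ) that satisfies clause i by xᵢ where `c i` holds and by yᵢ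
-- elsewhere.
minimal : (ℕ → Bool) → ℕ → Bool
minimal c zero = false
minimal c (suc zero) = true
minimal c (suc (suc k)) = pairs c k

minimal-x : ∀ c i → minimal c (xᵥ i) ≡ c i
minimal-x c zero = refl
minimal-x c (suc zero) = refl
minimal-x c (suc (suc i)) = minimal-x (c ∘ suc) (suc i)

minimal-y : ∀ c i → minimal c (yᵥ i) ≡ not (c i)
minimal-y c zero = refl
minimal-y c (suc zero) = refl
minimal-y c (suc (suc i)) = minimal-y (c ∘ suc) (suc i)

-- Binary digits, most significant first, with digit zero read as true: they code the choices on the
-- first `n` clauses.
bits : ∀ n → Fin (2 ^ n) → ℕ → Bool
bits zero k i = false
bits (suc n) k zero = does (quotient {2} (2 ^ n) k F.≟ zero)
bits (suc n) k (suc i) = bits n (remainder {2} (2 ^ n) k) i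

bits-injective : ∀ n {k l} → (∀ {i} → i < n → bits n k i ≡ bits n l i) → k ≡ l
bits-injective zero {zero} {zero} h = refl
bits-injective (suc n) {k} {l} h = begin
  k                            ≡⟨ F.combine-remQuot {2} (2 ^ n) k ⟨
  combine (quot k) (rem k)     ≡⟨ cong₂ combine (bit-injective (quot k) (quot l) (h (s≤s z≤n)))
                                    (bits-injective n (λ i<n → h (s≤s i<n))) ⟩
  combine (quot l) (rem l)     ≡⟨ F.combine-remQuot {2} (2 ^ n) l ⟩
  l                            ∎
  where
  open ≡-Reasoning
  quot = quotient {2} (2 ^ n)
  rem = remainder {2} (2 ^ n)
  bit-injective : ∀ (a b : Fin 2) → does (a F.≟ zero) ≡ does (b F.≟ zero) → a ≡ b
  bit-injective zero zero e = refl
  bit-injective (suc zero) (suc zero) e = refl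

quad : Y → Y → Y → Y → ℕ → Y
quad a b c d 0 = a
quad a b c d 1 = b
quad a b c d 2 = c
quad a b c d (suc (suc (suc _))) = d

absorb : Bool → Bool → Bool → Bool
absorb x y z = x ∧ (y ∨ z)

-- Values are decidable, so the failure of `ψ` can be located at an example; `φ` fits there, hence
-- the two formulas differ.
someMisfit : ∀ (φ ψ : PL O) (E : List Example) → All (Fits φ) E → ¬ All (Fits ψ) E →
  Any (λ e → ¬ eval ψ (proj₁ e) ≡ eval φ (proj₁ e)) E
someMisfit φ ψ [] [] ¬fits = contradiction [] ¬fits
someMisfit φ ψ ((V , b) ∷ E) (f ∷ fs) ¬fits with eval ψ V B.≟ eval φ V
... | yes e = there (someMisfit φ ψ E fs (λ gs → ¬fits (trans e f ∷ gs)))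
... | no ne = here ne

-- This makes dag size grow additively under substitution: however often `u` repeats a variable,
-- only the instances of its own subformulas are new.
sub-subformula : ∀ (u : PL O) (σ : ℕ → PL O) {ψ} → ψ ∈ subformulas (sub u σ) →
  ψ ∈ map (λ v → sub v σ) (subformulas u) ⊎ ∃ λ x → ψ ∈ subformulas (σ x)
sub-subformula (var x) σ p = inj₂ (x , p)
sub-subformula (app n f o as) σ (here e) = inj₁ (here e)
sub-subformula (app n f o as) σ (there p) with find (∈-concatMap⁻ _ {allFin (suc n)} p)
... | j , j∈ , q with sub-subformula (as j) σ q
...   | inj₂ r = inj₂ r
...   | inj₁ r with ∈-map⁻ _ r
...     | v , v∈ , refl = inj₁ (there (∈-map⁺ _ (∈-concatMap⁺ _ (lose j∈ v∈))))

-- Up to the sign s (V 3), the formula is x ∧ (y ∨ z); s = id makes majority such a formula.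
SignedAbsorb : (Bool → Bool) → PL O → Set
SignedAbsorb s t = ∀ V → s (V 3) xor eval t V ≡
  absorb (s (V 3) xor V 0) (s (V 3) xor V 1) (s (V 3) xor V 2)

module LowerBound {O : FunSet} (s : Bool → Bool) (t : PL O) (t-absorb : SignedAbsorb s t) where

  args : PL O → ℕ → ℕ → ℕ → PL O
  args φ x y = quad φ (var x) (var y) (var 0)

  step : PL O → PL O → PL O → PL O
  step φ ψ χ = sub t (quad φ ψ χ (var 0))

  -- Up to the sign, z ∧ ⋀_{i<k} (xᵢ ∨ yᵢ) with variable 1 as z.
  Φ : ℕ → PL O
  Φ zero = var 1
  Φ (suc k) = step (Φ k) (var (xᵥ k)) (var (yᵥ k))

  -- The variable of clause i that is false at the minimal model given by `c`.
  rejected : (ℕ → Bool) → ℕ → ℕ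
  rejected c i = if c i then yᵥ i else xᵥ i

  -- Φ n ∧ ⋁_{i<k} rejected c i
  Ψ : ℕ → (ℕ → Bool) → ℕ → PL O
  -- The clone need not contain false as the empty disjunction. Repeating the disjunct for i = 0
  -- makes the reading above correct for k > 0.
  Ψ n c zero = var (rejected c 0)
  Ψ n c (suc k) = step (Φ n) (var (rejected c k)) (Ψ n c k)

  module _ (V : Assignment) where

    ⟦_⟧ : PL O → Bool
    ⟦ φ ⟧ = s (V 0) xor eval φ V

    ⟦step⟧ : ∀ φ ψ χ → ⟦ step φ ψ χ ⟧ ≡ absorb ⟦ φ ⟧ ⟦ ψ ⟧ ⟦ χ ⟧
    ⟦step⟧ φ ψ χ = trans (cong (s (V 0) xor_) (eval-sub t _ V)) (t-absorb _)

    Φ-clause : ∀ n → ⟦ Φ n ⟧ ≡ true → ∀ {i} → i < n → ⟦ var (xᵥ i) ⟧ ∨ ⟦ var (yᵥ i) ⟧ ≡ true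
    Φ-clause (suc n) e {i} i<1+n with ∧-true⁻ (trans (sym (⟦step⟧ (Φ n) _ _)) e) | m<1+n⇒m<n∨m≡n i<1+n
    ... | e′ , _ | inj₁ i<n = Φ-clause n e′ i<n
    ... | _ , e′ | inj₂ refl = e′

    Ψ-false : ∀ n c k → ⟦ Φ n ⟧ ≡ false → ⟦ Ψ n c (suc k) ⟧ ≡ false
    Ψ-false n c k e = trans (⟦step⟧ (Φ n) _ _)
      (cong (λ b → absorb b ⟦ var (rejected c k) ⟧ ⟦ Ψ n c k ⟧) e)

    Ψ-rejects : ∀ n c k → ⟦ Φ n ⟧ ≡ true → ⟦ Ψ n c k ⟧ ≡ false →
      ∀ {i} → i < k → ⟦ var (rejected c i) ⟧ ≡ false
    Ψ-rejects n c (suc k) t e {i} i<1+k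
      with ∨-false⁻ (trans (sym (trans (⟦step⟧ (Φ n) _ _)
                  (cong (λ b → absorb b ⟦ var (rejected c k) ⟧ ⟦ Ψ n c k ⟧) t))) e)
         | m<1+n⇒m<n∨m≡n i<1+k
    ... | _ , e′ | inj₁ i<k = Ψ-rejects n c k t e′ i<k
    ... | e′ , _ | inj₂ refl = e′

    -- Ψ implies Φ up to the sign, so a difference means that Φ holds and Ψ fails. Then all rejected
    -- variables are false, and each clause makes its other variable true.
    Φ≢Ψ⇒minimal : ∀ n c → ¬ eval (Ψ (suc n) c (suc n)) V ≡ eval (Φ (suc n)) V →
      ∀ {i} → i < suc n → s (V 0) xor V (xᵥ i) ≡ c i
    Φ≢Ψ⇒minimal n c ne {i} i<n = go _ refl _ refl
      where
      go : ∀ a → ⟦ Φ (suc n) ⟧ ≡ a → ∀ b → ⟦ Ψ (suc n) c (suc n) ⟧ ≡ b → s (V 0) xor V (xᵥ i) ≡ c i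
      go false e b e′ = contradiction
        (xor-cancel (s (V 0)) (trans (Ψ-false (suc n) c n e) (sym e))) ne
      go true e true e′ = contradiction (xor-cancel (s (V 0)) (trans e′ (sym e))) ne
      go true e false e′ with c i | Ψ-rejects (suc n) c (suc n) e e′ i<n
      ... | false | x≡false = x≡false
      ... | true | y≡false =
        trans (sym (∨-identityʳ _)) (trans (cong (⟦ var (xᵥ i) ⟧ ∨_) (sym y≡false)) (Φ-clause (suc n) e i<n))

  -- The minimal model as a plain assignment: the sign variable is set to false, and the other
  -- variables are flipped by `s false`.
  point : (ℕ → Bool) → Assignment
  point c zero = false
  point c (suc k) = s false xor minimal c (suc k)

  ⟦point⟧ : ∀ c k → ⟦ point c ⟧ (var (suc k)) ≡ minimal c (suc k)
  ⟦point⟧ c k = xor-cancelˡ (s false) _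

  ⟦point-x⟧ : ∀ c i → ⟦ point c ⟧ (var (xᵥ i)) ≡ c i
  ⟦point-x⟧ c zero = ⟦point⟧ c 1
  ⟦point-x⟧ c (suc i) = trans (⟦point⟧ c (suc (xᵥ i))) (minimal-x c (suc i))

  ⟦point-y⟧ : ∀ c i → ⟦ point c ⟧ (var (yᵥ i)) ≡ not (c i)
  ⟦point-y⟧ c i = trans (⟦point⟧ c (xᵥ i)) (minimal-y c i)

  Φ-point : ∀ c n → ⟦ point c ⟧ (Φ n) ≡ true
  Φ-point c zero = ⟦point⟧ c 0
  Φ-point c (suc n) = trans (⟦step⟧ (point c) (Φ n) _ _)
    (trans (cong₂ _∧_ (Φ-point c n) (cong₂ _∨_ (⟦point-x⟧ c n) (⟦point-y⟧ c n))) (∨-inverseʳ (c n)))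

  rejected-point : ∀ c i → ⟦ point c ⟧ (var (rejected c i)) ≡ false
  rejected-point c i with c i in e
  ... | true = trans (⟦point-y⟧ c i) (cong not e)
  ... | false = trans (⟦point-x⟧ c i) e

  Ψ-point : ∀ n c k → ⟦ point c ⟧ (Ψ n c k) ≡ false
  Ψ-point n c zero = rejected-point c 0
  Ψ-point n c (suc k) = trans (⟦step⟧ (point c) (Φ n) _ _)
    (trans (cong (⟦ point c ⟧ (Φ n) ∧_) (cong₂ _∨_ (rejected-point c k) (Ψ-point n c k))) (∧-zeroʳ _))

  -- For each `c`, Ψ differs from Φ at `point c`, so it must misfit some example. That example
  -- determines `c` on the clauses, so different codes need different examples.
  examples≥ : ∀ n {E} → UniquelyCharacterizes O E (Φ (suc n)) → 2 ^ suc n ≤ length E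
  examples≥ n {E} (fits , unique) = matching⇒≤
    (λ k e → ∀ {i} → i < suc n → s (proj₁ e 0) xor proj₁ e (xᵥ i) ≡ bits (suc n) k i)
    (λ k → Any.map (λ {e} → Φ≢Ψ⇒minimal (proj₁ e) n (bits (suc n) k))
      (someMisfit (Φ (suc n)) (Ψ (suc n) (bits (suc n) k) (suc n)) E fits (misfits (bits (suc n) k))))
    (λ r r′ → bits-injective (suc n) (λ i<n → trans (sym (r i<n)) (r′ i<n)))
    where
    misfits : ∀ c → ¬ All (Fits (Ψ (suc n) c (suc n))) E
    misfits c fs = false≢true (Ψ-point (suc n) c (suc n))
      (trans (cong (s false xor_) (unique (Ψ (suc n) c (suc n)) fs (point c))) (Φ-point c (suc n)))

  -- A superset of the subformulas of `Φ k` that grows by a constant at each step, which makes the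
  -- dag size linear.
  cover : ℕ → List (PL O)
  cover zero = var 1 ∷ var 0 ∷ []
  cover (suc k) = map (λ u → sub u (args (Φ k) (xᵥ k) (yᵥ k))) (subformulas t) ++
    (var (xᵥ k) ∷ var (yᵥ k) ∷ cover k)

  length-cover : ∀ k → length (cover k) ≡ k * (length (subformulas t) + 2) + 2
  length-cover zero = refl
  length-cover (suc k)
    rewrite length-++ (map (λ u → sub u (args (Φ k) (xᵥ k) (yᵥ k))) (subformulas t))
                    {var (xᵥ k) ∷ var (yᵥ k) ∷ cover k}
          | length-map (λ u → sub u (args (Φ k) (xᵥ k) (yᵥ k))) (subformulas t)
          | length-cover k = trans (sym (+-assoc a 2 _)) (sym (+-assoc (a + 2) (k * (a + 2)) 2))
    where a = length (subformulas t)

  Φ⊆cover : ∀ n {ψ} → ψ ∈ subformulas (Φ n) → ψ ∈ cover n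
  Φ⊆cover zero (here e) = here e
  Φ⊆cover (suc k) p with sub-subformula t (args (Φ k) (xᵥ k) (yᵥ k)) p
  ... | inj₁ q = ∈-++⁺ˡ q
  ... | inj₂ (0 , q) = ∈-++⁺ʳ _ (there (there (Φ⊆cover k q)))
  ... | inj₂ (1 , here e) = ∈-++⁺ʳ _ (here e)
  ... | inj₂ (2 , here e) = ∈-++⁺ʳ _ (there (here e))
  ... | inj₂ (suc (suc (suc _)) , here refl) = ∈-++⁺ʳ _ (there (there (zero∈cover k)))
    where
    zero∈cover : ∀ k → var 0 ∈ cover k
    zero∈cover zero = there (here refl)
    zero∈cover (suc k) = ∈-++⁺ʳ _ (there (there (zero∈cover k)))

-- Growth

n<2^n : ∀ n → n < 2 ^ n
n<2^n zero = s≤s z≤n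
n<2^n (suc n) = begin-strict
  suc n          ≤⟨ n<2^n n ⟩
  2 ^ n          <⟨ m<m+n (2 ^ n) (m^n>0 2 n) ⟩
  2 ^ n + 2 ^ n  ≡⟨ cong (2 ^ n +_) (+-identityʳ _) ⟨
  2 ^ suc n      ∎
  where open ≤-Reasoning

evalPoly-mono : ∀ p {x y} → x ≤ y → evalPoly p x ≤ evalPoly p y
evalPoly-mono [] x≤y = z≤n
evalPoly-mono (c ∷ p) x≤y = +-monoʳ-≤ c (*-mono-≤ x≤y (evalPoly-mono p x≤y))

evalPoly≤ : ∀ p x → evalPoly p x ≤ sum p * suc x ^ length p
evalPoly≤ [] x = z≤n
evalPoly≤ (c ∷ p) x = begin
  c + x * evalPoly p x
    ≤⟨ +-mono-≤ (m≤m*n c (suc x ^ suc d) {{m^n≢0 (suc x) (suc d)}}) (*-mono-≤ (n≤1+n x) (evalPoly≤ p x)) ⟩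
  c * suc x ^ suc d + suc x * (sum p * suc x ^ d)
    ≡⟨ cong (c * suc x ^ suc d +_) (x∙yz≈y∙xz (suc x) (sum p) _) ⟩
  c * suc x ^ suc d + sum p * suc x ^ suc d
    ≡⟨ *-distribʳ-+ (suc x ^ suc d) c (sum p) ⟨
  (c + sum p) * suc x ^ suc d ∎
  where
  open ≤-Reasoning
  open import Algebra.Properties.CommutativeSemigroup *-commutativeSemigroup using (x∙yz≈y∙xz)
  d = length p

-- With j = c + 2d and k = 2j, the left side is c + j · 2d < (j + 1)² ≤ (2 ^ j)².
linear<exponential : ∀ c d → ∃ λ k → c + k * d < 2 ^ k
linear<exponential c d = j + j , (begin-strict
  c + (j + j) * d        ≡⟨ cong (c +_) (*-distribʳ-+ d j j) ⟩
  c + (j * d + j * d)    ≡⟨ cong (c +_) (*-distribˡ-+ j d d) ⟨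
  c + j * (d + d)
    <⟨ +-mono-<-≤ (s≤s (m≤m+n c (d + d))) (*-monoʳ-≤ j (≤-trans (m≤n+m (d + d) c) (n≤1+n j))) ⟩
  suc j * suc j          ≤⟨ *-mono-≤ (n<2^n j) (n<2^n j) ⟩
  2 ^ j * 2 ^ j          ≡⟨ ^-distribˡ-+-* 2 j j ⟨
  2 ^ (j + j)            ∎)
  where
  open ≤-Reasoning
  j = c + (d + d)

-- Taking n = 2 ^ k bounds the polynomial by 2 to a power linear in k, and a suitable k makes that
-- exponent smaller than n.
poly<exponential : ∀ p a → ∃ λ n → 0 < n × evalPoly p (n * a + 2) < 2 ^ n
poly<exponential p a with linear<exponential (sum p + (a + 3) * length p) (length p)
... | k , small = n , m^n>0 2 k , (begin-strict
  evalPoly p (n * a + 2)            ≤⟨ evalPoly≤ p _ ⟩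
  c * suc (n * a + 2) ^ d           ≤⟨ *-mono-≤ (<⇒≤ (n<2^n c)) (^-monoˡ-≤ d base) ⟩
  2 ^ c * (2 ^ (a + 3 + k)) ^ d     ≡⟨ cong (2 ^ c *_) (^-*-assoc 2 (a + 3 + k) d) ⟩
  2 ^ c * 2 ^ ((a + 3 + k) * d)     ≡⟨ ^-distribˡ-+-* 2 c _ ⟨
  2 ^ (c + (a + 3 + k) * d)
    ≡⟨ cong (2 ^_) (trans (cong (c +_) (*-distribʳ-+ d (a + 3) k)) (sym (+-assoc c _ _))) ⟩
  2 ^ (c + (a + 3) * d + k * d)     <⟨ ^-monoʳ-< 2 (s≤s (s≤s z≤n)) small ⟩
  2 ^ n                             ∎)
  where
  open ≤-Reasoning
  n = 2 ^ k
  c = sum p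
  d = length p
  base : suc (n * a + 2) ≤ 2 ^ (a + 3 + k)
  base = begin
    suc (n * a + 2)      ≡⟨ +-suc (n * a) 2 ⟨
    n * a + 3            ≤⟨ +-monoʳ-≤ (n * a) (m≤n*m 3 n {{m^n≢0 2 k}}) ⟩
    n * a + n * 3        ≡⟨ *-distribˡ-+ n a 3 ⟨
    n * (a + 3)          ≤⟨ *-monoʳ-≤ n (<⇒≤ (n<2^n (a + 3))) ⟩
    n * 2 ^ (a + 3)      ≡⟨ *-comm n _ ⟩
    2 ^ (a + 3) * 2 ^ k  ≡⟨ ^-distribˡ-+-* 2 (a + 3) k ⟨
    2 ^ (a + 3 + k)      ∎

PolynomiallyCharacterized : FunSet → Set
PolynomiallyCharacterized O =
  Σ (List ℕ) λ p → ∀ (φ : PL O) → CharacterizedWithin O φ (evalPoly p (dagSize φ))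

signedAbsorb⇒¬polynomial : ∀ s (t : PL O) → SignedAbsorb s t → ¬ PolynomiallyCharacterized O
signedAbsorb⇒¬polynomial s t t-absorb (p , H) with poly<exponential p (length (subformulas t) + 2)
... | suc n , _ , small with H (LowerBound.Φ s t t-absorb (suc n))
...   | E , E≤ , characterizes = <⇒≱ small (begin
  2 ^ suc n                             ≤⟨ examples≥ n characterizes ⟩
  length E                              ≤⟨ E≤ ⟩
  evalPoly p (dagSize (Φ (suc n)))      ≤⟨ evalPoly-mono p (dagSize≤ (Φ (suc n)) (cover (suc n)) (Φ⊆cover (suc n))) ⟩
  evalPoly p (length (cover (suc n)))   ≡⟨ cong (evalPoly p) (length-cover (suc n)) ⟩
  evalPoly p (suc n * (length (subformulas t) + 2) + 2) ∎)
  where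
  open ≤-Reasoning
  open LowerBound s t t-absorb

-- Minority

-- The values of variable `x` at all examples, packed into one number for the pigeonhole principle.
column : (E : List Example) → ℕ → Fin (2 ^ length E)
column [] x = zero
column ((V , _) ∷ E) x = combine {2} (if V x then suc zero else zero) (column E x)

column-injective : ∀ E {x y} → column E x ≡ column E y → All (λ e → proj₁ e x ≡ proj₁ e y) E
column-injective [] e = []
column-injective ((V , _) ∷ E) {x} {y} e with F.combine-injective {2} _ (column E x) _ (column E y) e
... | head , tail = bit-injective _ _ head ∷ column-injective E tail
  where
  bit-injective : ∀ a b → (if a then suc zero else zero {1}) ≡ (if b then suc zero else zero) → a ≡ b
  bit-injective true true e = refl
  bit-injective true false ()
  bit-injective false true ()
  bit-injective false false e = refl

-- Two variables y ≠ z with equal columns cancel on all examples, so that x ⊕ y ⊕ z fits whenever x does.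
minority⇒¬polynomial : (t : PL O) → (∀ V → eval t V ≡ V 0 xor (V 1 xor V 2)) →
  ¬ PolynomiallyCharacterized O
minority⇒¬polynomial {O} t t-xor (_ , H) with H (var 0)
-- The variables 1 to 2 ^ `length E` + 1 outnumber the possible columns; counting starts at 1 to
-- stay clear of `var 0`.
... | E , _ , fits , unique with F.pigeonhole (n<1+n (2 ^ length E)) (λ i → column E (suc (toℕ i)))
...   | i , j , i<j , same = contradiction (unique ψ (ψ-fits fits (column-injective E same)) only-y) different
  where
  y z : ℕ
  y = suc (toℕ i)
  z = suc (toℕ j)
  args : ℕ → PL O
  args 0 = var 0
  args 1 = var y
  args (suc (suc _)) = var z
  ψ = sub t args
  ψ-xor : ∀ V → eval ψ V ≡ V 0 xor (V y xor V z)
  ψ-xor V = trans (eval-sub t args V) (t-xor _)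
  ψ-fits : ∀ {E} → All (Fits {O} (var 0)) E → All (λ e → proj₁ e y ≡ proj₁ e z) E → All (Fits ψ) E
  ψ-fits [] [] = []
  ψ-fits {(V , _) ∷ _} (f ∷ fs) (e ∷ es) = trans (ψ-xor V) (trans
    (cong (V 0 xor_) (trans (cong (_xor V z) e) (xor-same (V z)))) (trans (xor-identityʳ (V 0)) f)) ∷ ψ-fits fs es
  only-y : Assignment
  only-y x = x ≡ᵇ y
  different : ¬ eval ψ only-y ≡ false
  different e with z ≡ᵇ y in z≡y
  ... | true = <⇒≢ (s≤s i<j) (sym (≡ᵇ⇒≡ z y (Equivalence.from T-≡ z≡y)))
  ... | false = false≢true e (trans (ψ-xor only-y) (cong₂ _xor_ (≡ᵇ-refl y) z≡y))

-- Operations of the clone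

-- Ternary operations suffice; those of smaller arity ignore an argument.
record Ternary (O : FunSet) (s : Bool) (h : Bool → Bool → Bool → Bool) : Set where
  constructor ternary
  field
    term    : PL O
    correct : ∀ V → ev s term V ≡ h (V 0) (V 1) (V 2)
open Ternary

Binary : FunSet → Bool → (Bool → Bool → Bool) → Set
Binary O s f = Ternary O s λ x y _ → f x y

triple : Y → Y → Y → ℕ → Y
triple a b c 0 = a
triple a b c 1 = b
triple a b c (suc (suc _)) = c

variable
  s : Bool
  f g : Bool → Bool → Bool
  h k p q r : Bool → Bool → Bool → Bool

x₀ : Ternary O s λ x y z → x
x₀ {O} {s} = ternary (var 0) λ V → ev-var {O = O} s 0 V
x₁ : Ternary O s λ x y z → y
x₁ {O} {s} = ternary (var 1) λ V → ev-var {O = O} s 1 V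
x₂ : Ternary O s λ x y z → z
x₂ {O} {s} = ternary (var 2) λ V → ev-var {O = O} s 2 V

ap₃ : Ternary O s h → Ternary O s p → Ternary O s q → Ternary O s r →
  Ternary O s λ x y z → h (p x y z) (q x y z) (r x y z)
ap₃ {s = s} {h = h} t a b c = ternary (sub (term t) args) λ V →
  trans (ev-sub s (term t) args V)
    (trans (correct t _) (cong₃ (correct a V) (correct b V) (correct c V)))
  where
  args = triple (term a) (term b) (term c)
  cong₃ : ∀ {x x′ y y′ z z′} → x ≡ x′ → y ≡ y′ → z ≡ z′ → h x y z ≡ h x′ y′ z′
  cong₃ refl refl refl = refl

ap₂ : Binary O s f → Ternary O s p → Ternary O s q → Ternary O s λ x y z → f (p x y z) (q x y z)
ap₂ t a b = ap₃ t a b b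

table₃ : (Bool → Bool → Bool → Bool) → Vec Bool 8
table₃ h =
  h true true true ∷ h true true false ∷ h true false true ∷ h true false false ∷
  h false true true ∷ h false true false ∷ h false false true ∷ h false false false ∷ []

table₃-injective : ∀ h k → table₃ h ≡ table₃ k → ∀ x y z → h x y z ≡ k x y z
table₃-injective h k e true true true = cong (λ v → lookup v (# 0)) e
table₃-injective h k e true true false = cong (λ v → lookup v (# 1)) e
table₃-injective h k e true false true = cong (λ v → lookup v (# 2)) e
table₃-injective h k e true false false = cong (λ v → lookup v (# 3)) e
table₃-injective h k e false true true = cong (λ v → lookup v (# 4)) e
table₃-injective h k e false true false = cong (λ v → lookup v (# 5)) e
table₃-injective h k e false false true = cong (λ v → lookup v (# 6)) e
table₃-injective h k e false false false = cong (λ v → lookup v (# 7)) e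

ternary-cong : (∀ x y z → h x y z ≡ k x y z) → Ternary O s h → Ternary O s k
ternary-cong e t = ternary (term t) λ V → trans (correct t V) (e _ _ _)

-- Comparing eight computed entries lets concrete identities between operations be proved by `refl`.
by-table : table₃ h ≡ table₃ k → Ternary O s h → Ternary O s k
by-table {h} {k} e = ternary-cong (table₃-injective h k e)

choose : ∀ b → Ternary O s h → Ternary O s k → Ternary O s λ x y z → if b then h x y z else k x y z
choose true t u = t
choose false t u = u

-- Substituting ternary operations cuts a term of any arity down to three arguments, where the case
-- analyses take place.
minor : (t : Fm O X) {H : X → Bool → Bool → Bool → Bool} → (∀ i → Ternary O s (H i)) →
  Ternary O s λ x y z → ev s t (λ i → H i x y z)
minor {s = s} t σ = ternary (sub t (term ∘ σ)) λ V →
  trans (ev-sub s t (term ∘ σ) V) (ev-cong s t (λ i → correct (σ i) V))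

table₂ : Bool → Bool → Bool → Bool → Bool → Bool → Bool
table₂ a b c d true true = a
table₂ a b c d true false = b
table₂ a b c d false true = c
table₂ a b c d false false = d

-- From meet to conjunctions

-- The table drops from true at (false, false) to false at (true, false). The guard `x` stands in
-- for the constant true, which the clone may lack.
nonmonotone⇒absorb : Binary O s _∧_ → ∀ a b →
  Ternary O s (λ x y z → x ∧ table₂ b false a true y z) → Ternary O s absorb
-- x ∧ ¬ (¬ y ∧ ¬ z)
nonmonotone⇒absorb and a false m =
  by-table refl (ap₃ m x₀ both both)
  where both = ap₂ and (ap₃ m x₀ x₁ x₁) (ap₃ m x₀ x₂ x₂)
-- the table is equivalence, and y ∨ z is y ⊕ z ⊕ (y ∧ z)
nonmonotone⇒absorb and false true m = by-table refl (ap₃ m x₀ (ap₃ m x₀ x₁ x₂) (ap₂ and x₁ x₂))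
-- the table is implication, and y ∨ z is (y ⇒ z) ⇒ z
nonmonotone⇒absorb and true true m = by-table refl (ap₃ m x₀ (ap₃ m x₀ x₁ x₂) x₂)

module _ {O : FunSet} (s : Bool) (and : Binary O s _∧_) (¬absorb : ¬ Ternary O s absorb) where

  -- If `t` were true at `a` and false at `b`, putting x on a, y on the rest of b and z elsewhere
  -- would give, behind the guard x, a nonmonotone binary table.
  meet-monotone : (t : Fm O X) (a b : X → Bool) → (∀ i → a i ≡ true → b i ≡ true) →
    ev s t a ≡ true → ev s t b ≡ true
  meet-monotone t a b a≤b ta with ev s t b in tb
  ... | true = refl
  ... | false = contradiction (nonmonotone⇒absorb and (H true false true) (H true true true)
      (ternary-cong guarded (ap₂ and x₀ (minor t (λ i → choose (a i) x₀ (choose (b i) x₁ x₂)))))) ¬absorb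
    where
    H : Bool → Bool → Bool → Bool
    H x y z = ev s t (λ i → if a i then x else if b i then y else z)
    H-a : H true false false ≡ true
    H-a = trans (ev-cong s t λ i → at-a (a i) (b i)) ta
      where
      at-a : ∀ a b → (if a then true else if b then false else false) ≡ a
      at-a true b = refl
      at-a false true = refl
      at-a false false = refl
    H-b : H true true false ≡ false
    H-b = trans (ev-cong s t λ i → at-b (a i) (b i) (a≤b i)) tb
      where
      at-b : ∀ a b → (a ≡ true → b ≡ true) → (if a then true else if b then true else false) ≡ b
      at-b true b a≤b = sym (a≤b refl)
      at-b false true a≤b = refl
      at-b false false a≤b = refl
    guarded : ∀ x y z → x ∧ H x y z ≡ x ∧ table₂ (H true true true) false (H true false true) true y z
    guarded false y z = refl
    guarded true true true = refl
    guarded true true false = H-b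
    guarded true false true = refl
    guarded true false false = H-a

  -- If `t` failed at the meet, putting x on the meet, y on the rest of a and z on the rest of b
  -- would give exactly `absorb` behind the guard x.
  meet-closed : (t : Fm O X) (a b : X → Bool) → ev s t a ≡ true → ev s t b ≡ true →
    ev s t (λ i → a i ∧ b i) ≡ true
  meet-closed t a b ta tb with ev s t (λ i → a i ∧ b i) in tab
  ... | true = refl
  ... | false = contradiction (ternary-cong guarded (ap₂ and x₀ (minor t λ i →
      choose (a i) (choose (b i) x₀ x₁) (choose (b i) x₂ (ap₂ and x₀ (ap₂ and x₁ x₂))))))
      ¬absorb
    where
    value : (a b x y z : Bool) → Bool
    -- Outside a and b the conjunction of all three serves as false; it is true only at (true, true,
    -- true), where monotonicity gives the value.
    value a b x y z = if a then if b then x else y else if b then z else (x ∧ (y ∧ z))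
    H : Bool → Bool → Bool → Bool
    H x y z = ev s t (λ i → value (a i) (b i) x y z)
    at : ∀ x y z (f : Bool → Bool → Bool) → (∀ a b → value a b x y z ≡ f a b) →
      ∀ {e} → ev s t (λ i → f (a i) (b i)) ≡ e → H x y z ≡ e
    at x y z f eq te = trans (ev-cong s t λ i → eq (a i) (b i)) te
    guarded : ∀ x y z → x ∧ H x y z ≡ absorb x y z
    guarded false y z = refl
    guarded true true true = at true true true (λ _ _ → true)
      (λ { true true → refl ; true false → refl ; false true → refl ; false false → refl })
      (meet-monotone t a (λ _ → true) (λ _ _ → refl) ta)
    guarded true true false = at true true false (λ a _ → a)
      (λ { true true → refl ; true false → refl ; false true → refl ; false false → refl }) ta
    guarded true false true = at true false true (λ _ b → b)
      (λ { true true → refl ; true false → refl ; false true → refl ; false false → refl }) tb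
    guarded true false false = at true false false _∧_
      (λ { true true → refl ; true false → refl ; false true → refl ; false false → refl }) tab

  -- The points where `t` is true are closed upward and under meets, so if there are any they form a
  -- principal filter. Its conjuncts are the i at whose coatom `t` is false.
  meet⇒conj : ∀ {n} (t : Fm O (Fin n)) → Σ (Conj (Fin n)) λ m → ∀ V → ev s t V ≡ conj m V
  meet⇒conj {n} t with ev s t (λ _ → true) in t-top
  ... | false = nothing , λ V → never V _ refl
    where
    never : ∀ V b → ev s t V ≡ b → ev s t V ≡ false
    never V false e = e
    never V true e = contradiction (meet-monotone t V (λ _ → true) (λ _ _ → refl) e) (false≢true t-top)
  ... | true = just needed , λ V → ≡-from-true
      (λ e → allᵇ⁺ needed (λ {i} p → forced V e i p))
      (λ e → meet-monotone t (above V (allFin n)) V (λ i e′ → above≤ V i e′) (above-true V e (allFin n)))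
    where
    all-but : Fin n → Fin n → Bool
    all-but i j = not (does (i F.≟ j))
    needed? : ∀ i → _
    needed? i = ev s t (all-but i) B.≟ false
    needed = filter needed? (allFin n)
    forced : ∀ V → ev s t V ≡ true → ∀ i → i ∈ needed → V i ≡ true
    forced V e i p with V i in Vi
    ... | true = refl
    ... | false = contradiction (meet-monotone t V (all-but i) below e)
            (false≢true (proj₂ (∈-filter⁻ needed? {xs = allFin n} p)))
      where
      below : ∀ j → V j ≡ true → all-but i j ≡ true
      below j Vj with i F.≟ j
      ... | yes refl = contradiction Vj (false≢true Vi)
      ... | no _ = refl
    -- the meet of the coatoms all-but i over those i in is with V i = false
    above : (Fin n → Bool) → List (Fin n) → Fin n → Bool
    above V is j = allᵇ (λ i → V i ∨ all-but i j) is
    above≤ : ∀ V j → above V (allFin n) j ≡ true → V j ≡ true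
    above≤ V j e with allᵇ⁻ e (∈-allFin j)
    ... | e′ with j F.≟ j
    ...   | yes _ = trans (sym (∨-identityʳ (V j))) e′
    ...   | no j≢j = contradiction refl j≢j
    above-true : ∀ V → allᵇ V needed ≡ true → ∀ is → ev s t (above V is) ≡ true
    above-true V e [] = t-top
    above-true V e (i ∷ is) = meet-closed t (λ j → V i ∨ all-but i j) (above V is) coatom (above-true V e is)
      where
      coatom : ev s t (λ j → V i ∨ all-but i j) ≡ true
      coatom with V i in Vi | ev s t (all-but i) in ti
      ... | true | _ = t-top
      ... | false | true = ti
      ... | false | false = contradiction (allᵇ⁻ e (∈-filter⁺ needed? (∈-allFin i) ti)) (false≢true Vi)

-- Self-dual idempotent operations

majority minority : Bool → Bool → Bool → Bool
majority x y z = (x ∧ (y ∨ z)) ∨ (y ∧ z)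
minority x y z = x xor (y xor z)

-- the self-dual idempotent operation with values a, b, c at the three unit vectors
selfDual : (a b c x y z : Bool) → Bool
selfDual a b c true true true = true
selfDual a b c true true false = not c
selfDual a b c true false true = not b
selfDual a b c true false false = a
selfDual a b c false true true = not a
selfDual a b c false true false = b
selfDual a b c false false true = c
selfDual a b c false false false = false

module _ {O : FunSet}
  (¬and : ¬ Binary O false _∧_) (¬or : ¬ Binary O false _∨_)
  (¬majority : ¬ Ternary O false majority) (¬minority : ¬ Ternary O false minority) where

  -- For b ≠ a the table is implication, equivalence, exclusive or, or x ∧ ¬ y, each of which
  -- generates an excluded operation.
  constant-diagonal : ∀ a b c → Binary O false (table₂ a b c a) → b ≡ a
  constant-diagonal true true c m = refl
  constant-diagonal true false true m = contradiction (by-table refl (ap₂ m m x₁)) ¬or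
  constant-diagonal true false false m = contradiction (by-table refl (ap₂ m m x₂)) ¬minority
  constant-diagonal false true true m = contradiction (by-table refl (ap₂ m m x₂)) ¬minority
  constant-diagonal false true false m = contradiction (by-table refl (ap₂ m x₀ m)) ¬and
  constant-diagonal false false c m = refl

  -- For c = b the table would be ∧, ∨, NAND or NOR, and the last two generate ∧ and ∨.
  permuting-diagonal : ∀ a b c → Binary O false (table₂ (not a) b c a) → c ≡ not b
  permuting-diagonal a true false m = refl
  permuting-diagonal a false true m = refl
  permuting-diagonal false true true m = contradiction (by-table refl m) ¬or
  permuting-diagonal false false false m = contradiction (by-table refl m) ¬and
  permuting-diagonal true true true m = contradiction (by-table refl (ap₂ m m m)) ¬and
  permuting-diagonal true false false m = contradiction (by-table refl (ap₂ m m m)) ¬or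

  -- `not c` is the value at (true, true, false). The violating patterns are minority, majority, and
  -- majority with its first or second argument negated, which generates majority.
  selfDual-additive : ∀ a b c → Ternary O false (selfDual a b c) → not c ≡ a ∨ b
  selfDual-additive false false false m = contradiction (by-table refl m) ¬majority
  selfDual-additive false false true m = refl
  selfDual-additive false true false m = refl
  selfDual-additive false true true m = contradiction (by-table refl (ap₃ m m x₁ x₂)) ¬majority
  selfDual-additive true b false m = refl
  selfDual-additive true false true m = contradiction (by-table refl (ap₃ m x₀ m x₂)) ¬majority
  selfDual-additive true true true m = contradiction (by-table refl m) ¬minority

  -- The sets on which such a term is true form an ultrafilter; being finite, it is principal.
  module _ {n} (t : Fm O (Fin n)) (t-bot : eval t (λ _ → false) ≡ false)
    (t-dual : ∀ a → eval t (not ∘ a) ≡ not (eval t a)) where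

    additive : ∀ a b → (∀ i → a i ∧ b i ≡ false) → eval t (λ i → a i ∨ b i) ≡ eval t a ∨ eval t b
    additive a b disjoint = trans (sym (not-involutive _)) (selfDual-additive (eval t a) (eval t b) c
      (ternary-cong value (minor t λ i → choose (a i) x₀ (choose (b i) x₁ x₂))))
      where
      -- By self-duality, the value of `t` on the complement of the union.
      c = not (eval t (λ i → a i ∨ b i))
      H : Bool → Bool → Bool → Bool
      H x y z = eval t (λ i → if a i then x else if b i then y else z)
      at : ∀ x y z (f : Bool → Bool → Bool) →
        (∀ a b → a ∧ b ≡ false → (if a then x else if b then y else z) ≡ f a b) →
        ∀ {e} → eval t (λ i → f (a i) (b i)) ≡ e → H x y z ≡ e
      at x y z f eq te = trans (eval-cong t λ i → eq (a i) (b i) (disjoint i)) te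
      value : ∀ x y z → H x y z ≡ selfDual (eval t a) (eval t b) c x y z
      value true true true = at true true true (λ _ _ → true)
        (λ { true b _ → refl ; false true _ → refl ; false false _ → refl })
        (trans (t-dual (λ _ → false)) (cong not t-bot))
      value true true false = at true true false _∨_
        (λ { true b _ → refl ; false true _ → refl ; false false _ → refl })
        (sym (not-involutive _))
      value true false true = at true false true (λ _ b → not b)
        (λ { true false _ → refl ; false true _ → refl ; false false _ → refl }) (t-dual b)
      value true false false = at true false false (λ a _ → a)
        (λ { true b _ → refl ; false true _ → refl ; false false _ → refl }) refl
      value false true true = at false true true (λ a _ → not a)
        (λ { true b _ → refl ; false true _ → refl ; false false _ → refl }) (t-dual a)
      value false true false = at false true false (λ _ b → b)
        (λ { true false _ → refl ; false true _ → refl ; false false _ → refl }) refl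
      value false false true = at false false true (λ a b → not (a ∨ b))
        (λ { true b _ → refl ; false true _ → refl ; false false _ → refl }) (t-dual _)
      value false false false = at false false false (λ _ _ → false)
        (λ { true b _ → refl ; false true _ → refl ; false false _ → refl }) t-bot

    minus : (a b : Fin n → Bool) → Fin n → Bool
    minus a b i = not (a i) ∧ b i

    minus-disjoint : ∀ a b i → a i ∧ minus a b i ≡ false
    minus-disjoint a b i with a i
    ... | true = refl
    ... | false = refl

    upward : ∀ a b → (∀ i → a i ≡ true → b i ≡ true) → eval t a ≡ true → eval t b ≡ true
    upward a b a≤b ta = trans (eval-cong t split)
      (trans (additive a (minus a b) (minus-disjoint a b)) (cong (_∨ eval t (minus a b)) ta))
      where
      split : ∀ i → b i ≡ a i ∨ minus a b i
      split i with a i in ai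
      ... | true = a≤b i ai
      ... | false = refl

    -- The union splits disjointly into a and b minus a, and the second part lies below b.
    union-false : ∀ a b → eval t a ≡ false → eval t b ≡ false → eval t (λ i → a i ∨ b i) ≡ false
    union-false a b ta tb with eval t (λ i → a i ∨ b i) in tab
    ... | false = refl
    ... | true = contradiction (upward (minus a b) b (λ i e → proj₂ (∧-true⁻ {not (a i)} e)) rest) (false≢true tb)
      where
      split : ∀ i → a i ∨ minus a b i ≡ a i ∨ b i
      split i with a i
      ... | true = refl
      ... | false = refl
      rest : eval t (minus a b) ≡ true
      rest = trans (sym (trans (additive a (minus a b) (minus-disjoint a b)) (cong (_∨ eval t (minus a b)) ta)))
        (trans (eval-cong t split) tab)

    singleton : Fin n → Fin n → Bool
    singleton i j = does (i F.≟ j)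

    singleton-self : ∀ i → singleton i i ≡ true
    singleton-self i with i F.≟ i
    ... | yes _ = refl
    ... | no i≢i = contradiction refl i≢i

    singleton-sound : ∀ {i j} → singleton i j ≡ true → i ≡ j
    singleton-sound {i} {j} e with i F.≟ j
    singleton-sound e | yes i≡j = i≡j
    singleton-sound () | no _

    projection : ∃ λ i → ∀ V → eval t V ≡ V i
    projection with F.any? (λ i → eval t (singleton i) B.≟ true)
    -- Without a true singleton, `t` would be false on the union of all singletons, the full set,
    -- where idempotence makes it true.
    ... | no none = contradiction (trans (cong not (sym t-bot)) (sym (t-dual _)))
          (λ e → false≢true (trans (eval-cong t (λ i → sym (covered i))) (union≡false (allFin n))) (sym e))
      where
      union : List (Fin n) → Fin n → Bool
      union [] j = false
      union (i ∷ is) j = singleton i j ∨ union is j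
      union≡false : ∀ is → eval t (union is) ≡ false
      union≡false [] = t-bot
      union≡false (i ∷ is) = union-false (singleton i) (union is) (¬-not λ e → none (i , e)) (union≡false is)
      member : ∀ {j is} → j ∈ is → union is j ≡ true
      member {j} {_ ∷ is} (here refl) = cong (_∨ union is j) (singleton-self j)
      member {j} {i ∷ is} (there p) = trans (cong (singleton i j ∨_) (member p)) (∨-zeroʳ _)
      covered : ∀ i → union (allFin n) i ≡ true
      covered i = member (∈-allFin i)
    ... | yes (i , ti) = i , λ V → value V _ refl
      where
      contains : ∀ V → V i ≡ true → eval t V ≡ true
      contains V Vi = upward (singleton i) V (λ j e → subst (λ k → V k ≡ true) (singleton-sound e) Vi) ti
      value : ∀ V b → V i ≡ b → eval t V ≡ b
      value V true Vi = contains V Vi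
      value V false Vi = trans (sym (not-involutive _))
        (trans (cong not (sym (t-dual V))) (cong not (contains (not ∘ V) (cong not Vi))))

  module _ {n} (t : Fm O (Fin n)) where

    top bot : Bool
    top = eval t (λ _ → true)
    bot = eval t (λ _ → false)

    binaryMinor : ∀ a → Binary O false (table₂ top (eval t a) (eval t (not ∘ a)) bot)
    binaryMinor a = ternary-cong (λ x y _ → value x y) (minor t λ i → choose (a i) x₀ x₁)
      where
      indicator : ∀ b → (if b then true else false) ≡ b
      indicator true = refl
      indicator false = refl
      complement : ∀ b → (if b then false else true) ≡ not b
      complement true = refl
      complement false = refl
      value : ∀ x y → eval t (λ i → if a i then x else y) ≡ table₂ top (eval t a) (eval t (not ∘ a)) bot x y
      value true true = eval-cong t λ i → if-eta (a i)
      value true false = eval-cong t λ i → indicator (a i)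
      value false true = eval-cong t λ i → complement (a i)
      value false false = eval-cong t λ i → if-eta (a i)

    -- t ∘ t is idempotent if the diagonal of t is a permutation
    twice : Fm O (Fin n)
    twice = sub t (λ _ → t)

    module _ (top≡ : top ≡ not bot) where

      twice-value : ∀ V → eval twice V ≡ bot xor eval t V
      twice-value V = trans (eval-sub t (λ _ → t) V) (at (eval t V))
        where
        at : ∀ b → eval t (λ _ → b) ≡ bot xor b
        at true = trans top≡ (sym (xor-comm bot true))
        at false = sym (xor-identityʳ bot)

      twice-bot : eval twice (λ _ → false) ≡ false
      twice-bot = trans (twice-value _) (xor-same bot)

      twice-dual : ∀ a → eval twice (not ∘ a) ≡ not (eval twice a)
      twice-dual a = begin
        eval twice (not ∘ a)       ≡⟨ twice-value (not ∘ a) ⟩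
        bot xor eval t (not ∘ a)   ≡⟨ cong (bot xor_) (permuting-diagonal bot _ _
          (subst (λ b → Binary O false (table₂ b (eval t a) (eval t (not ∘ a)) bot)) top≡ (binaryMinor a))) ⟩
        bot xor not (eval t a)     ≡⟨ not-distribʳ-xor bot (eval t a) ⟨
        not (bot xor eval t a)     ≡⟨ cong not (twice-value a) ⟨
        not (eval twice a)         ∎
        where open ≡-Reasoning

    -- If the diagonal is constant, all values equal `bot`. Otherwise `twice` is a projection, and
    -- `t` is its xor with `bot`.
    essentiallyUnary : UnaryForm t
    essentiallyUnary with top B.≟ bot
    ... | yes same = (bot , nothing) , λ V → constant-diagonal bot (eval t V) (eval t (not ∘ V))
      (subst (λ b → Binary O false (table₂ b (eval t V) (eval t (not ∘ V)) bot)) same (binaryMinor V))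
    ... | no differ with projection twice (twice-bot (¬-not differ)) (twice-dual (¬-not differ))
    ...   | i , twice≡ = (bot , just i) , λ V → trans (sym (xor-cancelˡ bot _))
      (cong (bot xor_) (trans (sym (twice-value (¬-not differ) V)) (twice≡ V)))

-- From operations of the clone to the dichotomy

signedAbsorb : (t : Ternary O s absorb) → SignedAbsorb (λ _ → s) (term t)
signedAbsorb {s = s} t V = trans (sym (ev-signed s (term t) V)) (correct t (λ x → s xor V x))

majority⇒¬polynomial : Ternary O false majority → ¬ PolynomiallyCharacterized O
majority⇒¬polynomial {O} (ternary m m-correct) =
  signedAbsorb⇒¬polynomial id (sub m args) λ V →
    trans (cong (V 3 xor_) (trans (eval-sub m args V) (trans (m-correct _)
      (cong (majority (V 3) (V 0)) (trans (eval-sub m (triple (var 0) (var 1) (var 2)) V) (m-correct _))))))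
      (identity (V 3) (V 0) (V 1) (V 2))
  where
  args : ℕ → PL O
  args = triple (var 3) (var 0) (sub m (triple (var 0) (var 1) (var 2)))
  identity : ∀ u x y z → u xor majority u x (majority x y z) ≡ absorb (u xor x) (u xor y) (u xor z)
  identity true = table₃-injective _ (λ x y z → absorb (not x) (not y) (not z)) refl
  identity false = table₃-injective _ absorb refl

∨⇒signed-∧ : Binary O false _∨_ → Binary O true _∧_
∨⇒signed-∧ (ternary t t-correct) = ternary t λ V → trans (cong not (t-correct _)) (de-morgan (V 0) (V 1))
  where
  de-morgan : ∀ a b → not (not a ∨ not b) ≡ a ∧ b
  de-morgan true b = not-involutive b
  de-morgan false b = refl

theorem3p20 : (O : FunSet) →
    (((O ⪯ AndTopBot) ⊎ (O ⪯ OrTopBot) ⊎ (O ⪯ NegBot)) →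
    ∀ (φ : PL O) → CharacterizedWithin O φ (dagSize φ + 1))
    ×
    (¬ ((O ⪯ AndTopBot) ⊎ (O ⪯ OrTopBot) ⊎ (O ⪯ NegBot)) →
    ¬ (Σ (List ℕ) λ p → ∀ (φ : PL O) → CharacterizedWithin O φ (evalPoly p (dagSize φ))))
theorem3p20 O = upper , lower
  where
  upper : _ → ∀ φ → CharacterizedWithin O φ (dagSize φ + 1)
  upper (inj₁ O⪯) = characterized-conj false (⪯Lat⇒conjFun false O⪯)
  upper (inj₂ (inj₁ O⪯)) = characterized-conj true (⪯Lat⇒conjFun true O⪯)
  upper (inj₂ (inj₂ O⪯)) = characterized-unary (⪯NegBot⇒unaryFun O⪯)
  lower : ¬ ((O ⪯ AndTopBot) ⊎ (O ⪯ OrTopBot) ⊎ (O ⪯ NegBot)) → ¬ PolynomiallyCharacterized O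
  -- A polynomial bound excludes majority, minority and, for both signs, `absorb`. Without `absorb`,
  -- having ∧ or ∨ would put `O` below a lattice case; with all four operations excluded, every term
  -- is essentially unary.
  lower ⋠ H = ⋠ (inj₂ (inj₂ (unaryTerms⇒⪯NegBot (essentiallyUnary
      (λ and → ⋠ (inj₁ (below-Lat false and)))
      (λ or → ⋠ (inj₂ (inj₁ (below-Lat true (∨⇒signed-∧ or)))))
      (λ m → majority⇒¬polynomial m H)
      (λ m → minority⇒¬polynomial (term m) (correct m) H)))))
    where
    below-Lat : ∀ s → Binary O s _∧_ → O ⪯ Lat s
    below-Lat s and = conjTerms⇒⪯Lat s (meet⇒conj s and
      (λ t → signedAbsorb⇒¬polynomial (λ _ → s) (term t) (signedAbsorb t) H))
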